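{- Let $R$ be a ring and let $A$, $B$, $C'$ be matrices over $R$ of sizes $p\times q$, $q\times r$ and $p\times r$, respectively. Suppose that $C'$ differs from the matrix product $C=A\times B$ in exactly one entry. Then there is a deterministic algorithm that, given $A$, $B$, $C'$, identifies this entry and corrects it (i.e., outputs $C$) in $O(pq+qr+pr)$ time, that is, in time linear in the total number of entries of the three matrices.
   Context: Running time is measured in a unit-cost model in which each ring operation (addition, subtraction, multiplication) and each elementary comparison or index operation costs $O(1)$. -}

module Defs where

open import Level using (Level)
open import Algebra.Bundles using (Ring)
import Algebra.Properties.Semiring.Sum as SemiringSum
open import Data.Bool.Base using (Bool; if_then_else_; _∧_)
open import Data.Fin.Base using (Fin; toℕ)
open import Data.List.Base using (List; []; _∷_; _++_)
open import Data.Nat.Base as ℕ using (ℕ; zero; suc; _≡ᵇ_; _<ᵇ_)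
open import Data.Product using (_×_; _,_; proj₁; proj₂; ∃!; ∃-syntax)
open import Data.Vec.Functional using (Vector)
open import Relation.Binary.Definitions using (Decidable)
open import Relation.Binary.PropositionalEquality using (_≡_)
open import Relation.Nullary.Decidable.Core using (does)

------------------------------------------------------------------------
-- Programs for a random access machine over a ring.
--
-- The machine has index registers holding natural numbers, ring registers
-- holding ring elements, and two-dimensional arrays of ring elements.
-- Programs are pure syntax: they mention neither the ring nor the matrix
-- sizes, and every instruction performs a single elementary operation.

IndexReg RingReg Array : Set
IndexReg = ℕ
RingReg  = ℕ
Array    = ℕ

data IndexOp : Set where
  lit   : ℕ → IndexOp
  copy  : IndexReg → IndexOp
  plus  : IndexReg → IndexReg → IndexOp
  -- truncated subtraction
  monus : IndexReg → IndexReg → IndexOp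

data RingOp : Set where
  zeroᴿ oneᴿ     : RingOp
  copy           : RingReg → RingOp
  add sub mul    : RingReg → RingReg → RingOp
  load           : Array → IndexReg → IndexReg → RingOp

data Test : Set where
  less equal : IndexReg → IndexReg → Test
  equalᴿ     : RingReg → RingReg → Test

data Instr : Set where
  setIndex   : IndexReg → IndexOp → Instr
  setRing    : RingReg → RingOp → Instr
  store      : Array → IndexReg → IndexReg → RingReg → Instr
  ifThenElse : Test → List Instr → List Instr → Instr
  while      : Test → List Instr → Instr

Program : Set
Program = List Instr

Matrix : ∀ {a} → Set a → ℕ → ℕ → Set a
Matrix X m n = Vector (Vector X n) m

module _ {c ℓ : Level} (R : Ring c ℓ) where

  open Ring R

  infixl 7 _⊗_

  _⊗_ : ∀ {p q r} → Matrix Carrier p q → Matrix Carrier q r → Matrix Carrier p r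
  (A ⊗ B) i j = sum (λ k → A i k * B k j)
    where open SemiringSum semiring using (sum)

  DifferAt : ∀ {m n} → Matrix Carrier m n → Matrix Carrier m n → Fin m × Fin n → Set ℓ
  DifferAt X Y (i , j) = X i j ≉ Y i j

  DifferInExactlyOneEntry : ∀ {m n} → Matrix Carrier m n → Matrix Carrier m n → Set ℓ
  DifferInExactlyOneEntry X Y = ∃! _≡_ (DifferAt X Y)

-- Equality tests on ring elements are a unit-cost operation of the machine,
-- hence the decision procedure.
module Machine {c ℓ : Level} (R : Ring c ℓ) (_≟_ : Decidable (Ring._≈_ R)) where

  open Ring R

  record State : Set c where
    constructor mkState
    field
      index : IndexReg → ℕ
      ring  : RingReg → Carrier
      array : Array → ℕ → ℕ → Carrier

  open State public

  evalIndex : IndexOp → State → ℕ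
  evalIndex (lit n)     σ = n
  evalIndex (copy x)    σ = index σ x
  evalIndex (plus x y)  σ = index σ x ℕ.+ index σ y
  evalIndex (monus x y) σ = index σ x ℕ.∸ index σ y

  evalRing : RingOp → State → Carrier
  evalRing zeroᴿ        σ = 0#
  evalRing oneᴿ         σ = 1#
  evalRing (copy x)     σ = ring σ x
  evalRing (add x y)    σ = ring σ x + ring σ y
  evalRing (sub x y)    σ = ring σ x - ring σ y
  evalRing (mul x y)    σ = ring σ x * ring σ y
  evalRing (load a x y) σ = array σ a (index σ x) (index σ y)

  evalTest : Test → State → Bool
  evalTest (less x y)   σ = index σ x <ᵇ index σ y
  evalTest (equal x y)  σ = index σ x ≡ᵇ index σ y
  evalTest (equalᴿ x y) σ = does (ring σ x ≟ ring σ y)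

  setIndexReg : IndexReg → ℕ → State → State
  setIndexReg x n σ = record σ { index = λ y → if y ≡ᵇ x then n else index σ y }

  setRingReg : RingReg → Carrier → State → State
  setRingReg x v σ = record σ { ring = λ y → if y ≡ᵇ x then v else ring σ y }

  setArray : Array → ℕ → ℕ → Carrier → State → State
  setArray a m n v σ = record σ
    { array = λ a′ m′ n′ → if (a′ ≡ᵇ a) ∧ (m′ ≡ᵇ m) ∧ (n′ ≡ᵇ n) then v else array σ a′ m′ n′ }

  -- The code still to be executed, and the current state.
  record Config : Set c where
    constructor ⟨_,_⟩
    field
      code  : Program
      state : State

  open Config public

  -- One unit of time; a configuration with no code left is halted.
  step : Config → Config
  step ⟨ []                     , σ ⟩ = ⟨ [] , σ ⟩
  step ⟨ setIndex x e ∷ k       , σ ⟩ = ⟨ k , setIndexReg x (evalIndex e σ) σ ⟩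
  step ⟨ setRing x e ∷ k        , σ ⟩ = ⟨ k , setRingReg x (evalRing e σ) σ ⟩
  step ⟨ store a x y z ∷ k      , σ ⟩ = ⟨ k , setArray a (index σ x) (index σ y) (ring σ z) σ ⟩
  step ⟨ ifThenElse b k₁ k₂ ∷ k , σ ⟩ = ⟨ (if evalTest b σ then k₁ else k₂) ++ k , σ ⟩
  step ⟨ while b k₁ ∷ k         , σ ⟩ =
    ⟨ (if evalTest b σ then k₁ ++ while b k₁ ∷ k else k) , σ ⟩

  run : ℕ → Config → Config
  run zero    γ = γ
  run (suc t) γ = run t (step γ)

  Holds : ∀ {m n} → State → Array → Matrix Carrier m n → Set ℓ
  Holds σ a M = ∀ i j → array σ a (toℕ i) (toℕ j) ≈ M i j

  -- Registers and array cells not mentioned here may have arbitrary contents.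
  record IsInput {p q r} (A : Matrix Carrier p q) (B : Matrix Carrier q r)
                 (C′ : Matrix Carrier p r) (σ : State) : Set ℓ where
    field
      p-given  : index σ 0 ≡ p
      q-given  : index σ 1 ≡ q
      r-given  : index σ 2 ≡ r
      A-given  : Holds σ 0 A
      B-given  : Holds σ 1 B
      C′-given : Holds σ 2 C′

  -- The position of the erroneous entry is returned in index registers 0
  -- and 1 (counting rows and columns from 0), and the correct product
  -- replaces the input C′ in array 2.
  record IsOutput {p r} (entry : Fin p × Fin r) (C : Matrix Carrier p r)
                  (σ : State) : Set ℓ where
    field
      row-found : index σ 0 ≡ toℕ (proj₁ entry)
      col-found : index σ 1 ≡ toℕ (proj₂ entry)
      corrected : Holds σ 2 C

  HaltsWithin : ℕ → Program → State → (State → Set ℓ) → Set ℓ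
  HaltsWithin T P σ Post =
    ∃[ t ] (t ℕ.≤ T × code (run t ⟨ P , σ ⟩) ≡ [] × Post (state (run t ⟨ P , σ ⟩)))

{-# OPTIONS --safe #-}

-- Let 1 be the all-ones vector.  The vectors A(B1) and C′1 are computed in
-- linear time, and their i-th entries are the sums of the i-th rows of AB and
-- of C′.  These sums agree in every row without an error, and they differ in
-- the row with the error, because exactly one summand has changed.  Once the
-- row is known, recomputing this single row of AB costs only O(qr) and reveals
-- both the column and the correct value.
module Submission where

open import Algebra.Bundles using (Ring)
import Algebra.Properties.Group as GroupProperties
import Algebra.Properties.Semiring.Sum as SemiringSum
open import Data.Bool.Base using (true; false)
open import Data.Fin.Base using (Fin; toℕ; fromℕ; fromℕ<; inject₁; punchIn)
open import Data.Fin.Properties as Fin using (toℕ-fromℕ; toℕ-fromℕ<; toℕ-inject₁; toℕ-injective; toℕ<n; punchInᵢ≢i)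
open import Data.List.Base using (List; []; _∷_; _++_)
open import Data.List.Properties using (++-assoc; ++-identityʳ)
open import Data.Nat.Base using (ℕ; zero; suc; _+_; _*_; _≤_; _<_; z≤n; s≤s; _≡ᵇ_; _<ᵇ_)
open import Data.Nat.Properties as ℕ using (≤-refl; ≤-trans; ≤-reflexive; +-mono-≤; m≤m+n)
open import Data.Nat.Tactic.RingSolver using (solve-∀)
open import Data.Product using (Σ-syntax; ∃-syntax; _×_; _,_; proj₁; proj₂)
open import Level using (Level; _⊔_)
open import Relation.Binary.Definitions using (Decidable)
open import Relation.Binary.PropositionalEquality as ≡ using (_≡_; _≢_; cong; cong₂; subst)
open import Relation.Nullary using (¬_; yes; no)
open import Relation.Nullary.Decidable using (dec-true; dec-false; decidable-stable)
open import Defs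

-- The program

-- `one` is set to the constant 1, because index addition takes only registers. `row` and `col`
-- differ from the output registers 0 and 1, which hold the loop bounds `p` and `q` until the very
-- end.
one outer inner row col : IndexReg
one   = 3
outer = 4
inner = 5
row   = 6
col   = 7

-- `kept` holds a value that must survive later accumulations: first a row sum of the product, then
-- the corrected entry.
acc term factor kept : RingReg
acc    = 0
term   = 1
factor = 2
kept   = 3

-- The code after the loop is an argument, so that programs stay in the cons form on which the
-- execution rules act. `loadTerm` has to leave the next summand in `term`.
accumulate : IndexReg → List Instr → Program → Program
accumulate n loadTerm P =
  setRing acc zeroᴿ ∷
  setIndex inner (lit 0) ∷
  while (less inner n)
    (loadTerm ++ setRing acc (add acc term) ∷ setIndex inner (plus inner one) ∷ []) ∷
  P

loadB loadAv loadC′ loadAB : List Instr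
loadB  = setRing term (load 1 outer inner) ∷ []
loadAv = setRing term (load 0 outer inner) ∷
         setRing factor (load 3 inner inner) ∷
         setRing term (mul term factor) ∷ []
loadC′ = setRing term (load 2 outer inner) ∷ []
loadAB = setRing term (load 0 row inner) ∷
         setRing factor (load 1 inner outer) ∷
         setRing term (mul term factor) ∷ []

increment : Program
increment = setIndex outer (plus outer one) ∷ []

-- The vector v = B1 is stored on the diagonal of array 3, which saves a
-- register for a constant second index.
sumRowsOfB findRow findCol correctEntry : Program
sumRowsOfB = accumulate 2 loadB (store 3 outer outer acc ∷ increment)
findRow =
  accumulate 1 loadAv (
  setRing kept (copy acc) ∷
  accumulate 2 loadC′ (
  ifThenElse (equalᴿ acc kept) [] (setIndex row (copy outer) ∷ []) ∷
  increment))
findCol =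
  accumulate 1 loadAB (
  setRing term (load 2 row outer) ∷
  ifThenElse (equalᴿ acc term) [] (setIndex col (copy outer) ∷ setRing kept (copy acc) ∷ []) ∷
  increment)
correctEntry =
  store 2 row col kept ∷
  setIndex 0 (copy row) ∷
  setIndex 1 (copy col) ∷ []

corrector : Program
corrector =
  setIndex one (lit 1) ∷
  setIndex outer (lit 0) ∷
  while (less outer 1) sumRowsOfB ∷
  setIndex outer (lit 0) ∷
  while (less outer 0) findRow ∷
  setIndex outer (lit 0) ∷
  while (less outer 2) findCol ∷
  correctEntry

-- Boolean comparisons of natural numbers

<⇒<ᵇ≡true : ∀ {m n} → m < n → (m <ᵇ n) ≡ true
<⇒<ᵇ≡true {m} {n} = dec-true (m ℕ.<? n)

n<ᵇn≡false : ∀ n → (n <ᵇ n) ≡ false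
n<ᵇn≡false n = dec-false (n ℕ.<? n) (ℕ.<-irrefl ≡.refl)

≡⇒≡ᵇ≡true : ∀ {m n} → m ≡ n → (m ≡ᵇ n) ≡ true
≡⇒≡ᵇ≡true {m} {n} = dec-true (m ℕ.≟ n)

≢⇒≡ᵇ≡false : ∀ {m n} → m ≢ n → (m ≡ᵇ n) ≡ false
≢⇒≡ᵇ≡false {m} {n} = dec-false (m ℕ.≟ n)

-- Finite sums in a ring

module _ {c ℓ : Level} (R : Ring c ℓ) where

  open Ring R using (Carrier; _≈_; setoid; trans; reflexive; +-cong; +-congˡ; +-group; semiring)
    renaming (_+_ to _⊕_; _*_ to _⊙_)
  open SemiringSum semiring using (sum; sum-cong-≋; sum-init-last; sum-remove; ∑-comm; *-distribˡ-sum)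
  open import Relation.Binary.Reasoning.Setoid setoid

  -- `sum` unfolds at its first term, whereas a loop appends the last one; this is the recurrence a
  -- loop follows.
  sum-toℕ-suc : ∀ (g : ℕ → Carrier) n →
    sum {suc n} (λ i → g (toℕ i)) ≈ sum {n} (λ i → g (toℕ i)) ⊕ g n
  sum-toℕ-suc g n = begin
    sum {suc n} (λ i → g (toℕ i))                           ≈⟨ sum-init-last {n} (λ i → g (toℕ i)) ⟩
    sum {n} (λ i → g (toℕ (inject₁ i))) ⊕ g (toℕ (fromℕ n)) ≈⟨ +-cong
      (sum-cong-≋ {n} {λ i → g (toℕ (inject₁ i))} {λ i → g (toℕ i)} (λ i → reflexive (cong g (toℕ-inject₁ i))))
      (reflexive (cong g (toℕ-fromℕ n))) ⟩
    sum {n} (λ i → g (toℕ i)) ⊕ g n                         ∎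

  -- With the `i`-th terms moved to the front, the remainders agree termwise and cancel in the
  -- additive group. In contrapositive form, a single wrong entry always changes its row sum.
  sum-cancel : ∀ {n} (f g : Fin n → Carrier) i →
    (∀ j → i ≢ j → f j ≈ g j) → sum f ≈ sum g → f i ≈ g i
  sum-cancel {suc n} f g i f≈g Σf≈Σg =
    GroupProperties.∙-cancelʳ +-group _ _ _ (begin
      f i ⊕ sum (λ j → f (punchIn i j))  ≈⟨ sum-remove f ⟨
      sum f                              ≈⟨ Σf≈Σg ⟩
      sum g                              ≈⟨ sum-remove g ⟩
      g i ⊕ sum (λ j → g (punchIn i j))  ≈⟨ +-congˡ (sum-cong-≋ (λ j → f≈g _ (λ eq → punchInᵢ≢i i j (≡.sym eq)))) ⟨
      g i ⊕ sum (λ j → f (punchIn i j))  ∎)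

  -- This is A(B1) = (AB)1, obtained from distributivity and an exchange of the two summations.
  ⊗-rowSum : ∀ {p q r} (A : Matrix Carrier p q) (B : Matrix Carrier q r) i →
    sum (λ k → A i k ⊙ sum (B k)) ≈ sum (_⊗_ R A B i)
  ⊗-rowSum A B i = trans (sum-cong-≋ (λ k → *-distribˡ-sum (A i k) (B k)))
                         (∑-comm (λ k j → A i k ⊙ B k j))

module _ {c ℓ : Level} (R : Ring c ℓ) (_≟_ : Decidable (Ring._≈_ R)) where

  open Ring R using (Carrier; _≈_; sym; trans; refl; reflexive; 0#; +-cong; *-cong; semiring)
    renaming (_+_ to _⊕_; _*_ to _⊙_)
  open SemiringSum semiring using (sum; sum-cong-≋)
  open Machine R _≟_

  -- Total correctness with a time bound

  -- The time `t` and the final state are chosen before the continuation `k`, so the run of `P` does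
  -- not depend on what follows it. This is what makes executions compose.
  Executes : ∀ {a} → Program → State → ℕ → (State → Set a) → Set (c ⊔ a)
  Executes P σ T Q =
    ∃[ t ] ∃[ σ′ ] (t ≤ T × (∀ k → run t ⟨ P ++ k , σ ⟩ ≡ ⟨ k , σ′ ⟩) × Q σ′)

  run-+ : ∀ s t γ → run (s + t) γ ≡ run t (run s γ)
  run-+ zero    t γ = ≡.refl
  run-+ (suc s) t γ = run-+ s t (step γ)

  module _ {a : Level} {Q : State → Set a} where

    weaken : ∀ {P σ S T} → S ≤ T → Executes P σ S Q → Executes P σ T Q
    weaken S≤T (t , σ′ , t≤S , runs , post) = t , σ′ , ≤-trans t≤S S≤T , runs , post

    halts : ∀ {σ} → Q σ → Executes [] σ 0 Q
    halts post = 0 , _ , z≤n , (λ _ → ≡.refl) , post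

    executes-setIndex : ∀ {x e P σ T} → Executes P (setIndexReg x (evalIndex e σ) σ) T Q →
      Executes (setIndex x e ∷ P) σ (suc T) Q
    executes-setIndex (t , σ′ , t≤T , runs , post) = suc t , σ′ , s≤s t≤T , runs , post

    executes-setRing : ∀ {x e P σ T} → Executes P (setRingReg x (evalRing e σ) σ) T Q →
      Executes (setRing x e ∷ P) σ (suc T) Q
    executes-setRing (t , σ′ , t≤T , runs , post) = suc t , σ′ , s≤s t≤T , runs , post

    executes-store : ∀ {a x y z P σ T} →
      Executes P (setArray a (index σ x) (index σ y) (ring σ z) σ) T Q →
      Executes (store a x y z ∷ P) σ (suc T) Q
    executes-store (t , σ′ , t≤T , runs , post) = suc t , σ′ , s≤s t≤T , runs , post

    executes-then : ∀ {b k₁ k₂ P σ T} → evalTest b σ ≡ true →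
      Executes (k₁ ++ P) σ T Q → Executes (ifThenElse b k₁ k₂ ∷ P) σ (suc T) Q
    executes-then {b} {k₁} {k₂} {P} {σ} b-true (t , σ′ , t≤T , runs , post) =
      suc t , σ′ , s≤s t≤T , runs′ , post
      where
      runs′ : ∀ k → run (suc t) ⟨ ifThenElse b k₁ k₂ ∷ P ++ k , σ ⟩ ≡ ⟨ k , σ′ ⟩
      runs′ k rewrite b-true | ≡.sym (++-assoc k₁ P k) = runs k

    executes-else : ∀ {b k₁ k₂ P σ T} → evalTest b σ ≡ false →
      Executes (k₂ ++ P) σ T Q → Executes (ifThenElse b k₁ k₂ ∷ P) σ (suc T) Q
    executes-else {b} {k₁} {k₂} {P} {σ} b-false (t , σ′ , t≤T , runs , post) =
      suc t , σ′ , s≤s t≤T , runs′ , post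
      where
      runs′ : ∀ k → run (suc t) ⟨ ifThenElse b k₁ k₂ ∷ P ++ k , σ ⟩ ≡ ⟨ k , σ′ ⟩
      runs′ k rewrite b-false | ≡.sym (++-assoc k₂ P k) = runs k

    executes-++ : ∀ {a′ P P′ σ S T} {Q′ : State → Set a′} →
      Executes P σ S Q′ → (∀ σ′ → Q′ σ′ → Executes P′ σ′ T Q) → Executes (P ++ P′) σ (S + T) Q
    executes-++ {P = P} {P′} {σ} (s , σ′ , s≤S , runs , mid) rest with rest σ′ mid
    ... | t , σ″ , t≤T , runs′ , post = s + t , σ″ , +-mono-≤ s≤S t≤T , runs″ , post
      where
      runs″ : ∀ k → run (s + t) ⟨ (P ++ P′) ++ k , σ ⟩ ≡ ⟨ k , σ″ ⟩
      -- With `P′ ++ k` as its continuation, the first run ends exactly where the second begins.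
      runs″ k rewrite ++-assoc P P′ k | run-+ s t ⟨ P ++ P′ ++ k , σ ⟩ | runs (P′ ++ k) = runs′ k

    executes-loop : ∀ {b body P σ T} → evalTest b σ ≡ true →
      Executes (body ++ while b body ∷ P) σ T Q → Executes (while b body ∷ P) σ (suc T) Q
    executes-loop {b} {body} {P} {σ} b-true (t , σ′ , t≤T , runs , post) =
      suc t , σ′ , s≤s t≤T , runs′ , post
      where
      runs′ : ∀ k → run (suc t) ⟨ while b body ∷ P ++ k , σ ⟩ ≡ ⟨ k , σ′ ⟩
      runs′ k rewrite b-true | ≡.sym (++-assoc body (while b body ∷ P) k) = runs k

    executes-exit : ∀ {b body P σ T} → evalTest b σ ≡ false →
      Executes P σ T Q → Executes (while b body ∷ P) σ (suc T) Q
    executes-exit {b} {body} {P} {σ} b-false (t , σ′ , t≤T , runs , post) =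
      suc t , σ′ , s≤s t≤T , runs′ , post
      where
      runs′ : ∀ k → run (suc t) ⟨ while b body ∷ P ++ k , σ ⟩ ≡ ⟨ k , σ′ ⟩
      runs′ k rewrite b-false = runs k

    -- Induction on the number of remaining rounds. Each round costs one test and at most `S` steps,
    -- and the failing test costs one more. Rounds are indexed by `Fin N`, so that the counter can
    -- serve as a matrix index.
    executes-for : ∀ {i x n body P σ N S T} (Inv : ℕ → State → Set i) →
      (∀ m σ → Inv m σ → index σ x ≡ m × index σ n ≡ N) →
      (∀ (m : Fin N) σ → Inv (toℕ m) σ → Executes body σ S (Inv (suc (toℕ m)))) →
      Inv 0 σ →
      (∀ σ′ → Inv N σ′ → Executes P σ′ T Q) →
      Executes (while (less x n) body ∷ P) σ (N * suc S + suc T) Q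
    executes-for {x = x} {n} {body} {P} {σ₀} {N} {S} {T} Inv counters iterate start rest =
      go N 0 σ₀ ≡.refl start
      where
      go : ∀ d m σ → m + d ≡ N → Inv m σ →
        Executes (while (less x n) body ∷ P) σ (d * suc S + suc T) Q
      go zero m σ m+0≡N inv = executes-exit
        (≡.trans (cong₂ _<ᵇ_ (≡.trans (proj₁ (counters m σ inv)) m≡N) (proj₂ (counters m σ inv)))
                 (n<ᵇn≡false N))
        (rest σ (subst (λ z → Inv z σ) m≡N inv))
        where
        m≡N : m ≡ N
        m≡N = ≡.trans (≡.sym (ℕ.+-identityʳ m)) m+0≡N
      go (suc d) m σ m+1+d≡N inv = executes-loop
        (≡.trans (cong₂ _<ᵇ_ (proj₁ (counters m σ inv)) (proj₂ (counters m σ inv))) (<⇒<ᵇ≡true m<N))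
        (weaken (≤-reflexive (≡.sym (ℕ.+-assoc S (d * suc S) (suc T))))
          (executes-++ body-executes (λ σ′ → go d (suc m) σ′ 1+m+d≡N)))
        where
        1+m+d≡N : suc m + d ≡ N
        1+m+d≡N = ≡.trans (≡.sym (ℕ.+-suc m d)) m+1+d≡N
        m<N : m < N
        m<N = subst (suc m ≤_) 1+m+d≡N (m≤m+n (suc m) d)
        body-executes : Executes body σ S (Inv (suc m))
        body-executes = subst (λ z → Executes body σ S (Inv (suc z))) (toℕ-fromℕ< m<N)
          (iterate (fromℕ< m<N) σ (subst (λ z → Inv z σ) (≡.sym (toℕ-fromℕ< m<N)) inv))

  Executes⇒HaltsWithin : ∀ {P σ T Q} → Executes P σ T Q → HaltsWithin T P σ Q
  Executes⇒HaltsWithin {P} {σ} {Q = Q} (t , σ′ , t≤T , runs , post) =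
    t , t≤T , cong code halted , subst Q (cong state (≡.sym halted)) post
    where
    halted : run t ⟨ P , σ ⟩ ≡ ⟨ [] , σ′ ⟩
    halted = subst (λ k → run t ⟨ k , σ ⟩ ≡ ⟨ [] , σ′ ⟩) (++-identityʳ P) (runs [])

  -- Accumulation loops

  -- What an accumulation must preserve; `inner`, `acc`, `term` and `factor` are scratch. The
  -- Boolean premise reduces for literal registers, so that `refl` proves it.
  Frame : State → State → Set c
  Frame σ σ′ =
    (∀ x → (x ≡ᵇ inner) ≡ false → index σ′ x ≡ index σ x) ×
    ring σ′ kept ≡ ring σ kept ×
    array σ′ ≡ array σ

  -- The bound 3 is the length of the longest loaders, `loadAv` and `loadAB`.
  LoadsTerm : List Instr → State → Carrier → Set c
  LoadsTerm loadTerm σ v = Executes loadTerm σ 3 λ σ′ →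
    index σ′ ≡ index σ × array σ′ ≡ array σ ×
    ring σ′ acc ≡ ring σ acc × ring σ′ kept ≡ ring σ kept × ring σ′ term ≡ v

  -- Invariant: `acc` is the sum of the first `inner` terms. A round costs at most 6: one test,
  -- three steps of loading, one addition and one increment. The leading 3 counts the two
  -- initialisations and the failing test.
  executes-accumulate : ∀ {a n P σ N T} {Q : State → Set a} loadTerm (g : ℕ → Carrier) →
    (n ≡ᵇ inner) ≡ false → index σ n ≡ N → index σ one ≡ 1 →
    (∀ σ′ → Frame σ σ′ → LoadsTerm loadTerm σ′ (g (index σ′ inner))) →
    (∀ σ′ → Frame σ σ′ → ring σ′ acc ≈ sum {N} (λ i → g (toℕ i)) → Executes P σ′ T Q) →
    Executes (accumulate n loadTerm P) σ (3 + (N * 6 + T)) Q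
  executes-accumulate {n = n} {P} {σ} {N} {T} loadTerm g n≢inner n≡N one≡1 loads rest =
    weaken (s≤s (s≤s (≤-reflexive (ℕ.+-suc (N * 6) T))))
      (executes-setRing (executes-setIndex
        (executes-for Inv counters iterate
          (≡.refl , refl , frame₀ , ≡.refl , ≡.refl)
          (λ σ′ (_ , acc≈ , frame) → rest σ′ frame acc≈))))
    where
    Inv : ℕ → State → Set (c ⊔ ℓ)
    Inv m σ′ = index σ′ inner ≡ m × ring σ′ acc ≈ sum {m} (λ i → g (toℕ i)) × Frame σ σ′

    frame₀ : ∀ x → (x ≡ᵇ inner) ≡ false →
      index (setIndexReg inner 0 (setRingReg acc 0# σ)) x ≡ index σ x
    frame₀ x x≢inner rewrite x≢inner = ≡.refl

    counters : ∀ m σ′ → Inv m σ′ → index σ′ inner ≡ m × index σ′ n ≡ N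
    counters m σ′ (inner≡m , _ , index≡ , _) = inner≡m , ≡.trans (index≡ n n≢inner) n≡N

    iterate : ∀ (m : Fin N) σ′ → Inv (toℕ m) σ′ →
      Executes (loadTerm ++ setRing acc (add acc term) ∷ setIndex inner (plus inner one) ∷ [])
        σ′ 5 (Inv (suc (toℕ m)))
    iterate m σ′ (inner≡m , acc≈ , frame@(index≡ , kept≡ , array≡)) =
      executes-++ (loads σ′ frame) λ σ″ (index″ , array″ , acc″ , kept″ , term″) →
        executes-setRing (executes-setIndex (halts
          ( ≡.trans (cong₂ _+_ (≡.trans (cong (λ f → f inner) index″) inner≡m)
                               (≡.trans (cong (λ f → f one) index″) (≡.trans (index≡ one ≡.refl) one≡1)))
                    (ℕ.+-comm (toℕ m) 1)
          , trans (+-cong (trans (reflexive acc″) acc≈)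
                          (reflexive (≡.trans term″ (cong g inner≡m))))
                  (sym (sum-toℕ-suc R g (toℕ m)))
          , preserved σ″ index″ , ≡.trans kept″ kept≡ , ≡.trans array″ array≡)))
      where
      preserved : ∀ σ″ → index σ″ ≡ index σ′ → ∀ x → (x ≡ᵇ inner) ≡ false →
        index (setIndexReg inner (index σ″ inner + index σ″ one) σ″) x ≡ index σ x
      preserved σ″ index″ x x≢inner rewrite x≢inner =
        ≡.trans (cong (λ f → f x) index″) (index≡ x x≢inner)

  -- Correctness of the program on a fixed input

  module _ {p q r : ℕ} (A : Matrix Carrier p q) (B : Matrix Carrier q r) (C′ : Matrix Carrier p r)
           (d : DifferInExactlyOneEntry R C′ (_⊗_ R A B)) where

    C : Matrix Carrier p r
    C = _⊗_ R A B

    i₀ : Fin p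
    i₀ = proj₁ (proj₁ d)

    j₀ : Fin r
    j₀ = proj₂ (proj₁ d)

    -- Uniqueness of the error gives only the double negation of equality, which decidability
    -- removes.
    C′≈C : ∀ i j → (i₀ , j₀) ≢ (i , j) → C′ i j ≈ C i j
    C′≈C i j ≢ij = decidable-stable (C′ i j ≟ C i j) (λ differ → ≢ij (proj₂ (proj₂ d) differ))

    rowSum≈ : ∀ i → i₀ ≢ i → sum (C′ i) ≈ sum (C i)
    rowSum≈ i i₀≢i = sum-cong-≋ (λ j → C′≈C i j (λ eq → i₀≢i (cong proj₁ eq)))

    rowSum≉ : ¬ sum (C′ i₀) ≈ sum (C i₀)
    rowSum≉ eq = proj₁ (proj₂ d)
      (sum-cancel R (C′ i₀) (C i₀) j₀ (λ j j₀≢j → C′≈C i₀ j (λ eq′ → j₀≢j (cong proj₂ eq′))) eq)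

    -- A product rather than a record, so that it is preserved definitionally
    -- by updates of the other registers and arrays.
    Setup : State → Set ℓ
    Setup σ = index σ 0 ≡ p × index σ 1 ≡ q × index σ 2 ≡ r × index σ one ≡ 1 ×
              Holds σ 0 A × Holds σ 1 B × Holds σ 2 C′

    Setup-frame : ∀ σ σ′ → Frame σ σ′ → Setup σ → Setup σ′
    -- Opening both records turns the equation between arrays into one between variables, so that it
    -- can be matched with `refl`.
    Setup-frame (mkState _ _ _) (mkState _ _ _) (index≡ , _ , ≡.refl) (p≡ , q≡ , r≡ , one≡ , holds) =
      ≡.trans (index≡ 0 ≡.refl) p≡ , ≡.trans (index≡ 1 ≡.refl) q≡ ,
      ≡.trans (index≡ 2 ≡.refl) r≡ , ≡.trans (index≡ one ≡.refl) one≡ , holds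

    increment≡ : ∀ σ {m} → Setup σ → index σ outer ≡ m → index σ outer + index σ one ≡ suc m
    increment≡ _ {m} (_ , _ , _ , one≡ , _) outer≡ =
      ≡.trans (cong₂ _+_ outer≡ one≡) (ℕ.+-comm m 1)

    HoldsRowSums : ℕ → State → Set ℓ
    HoldsRowSums m σ = ∀ (k : Fin q) → toℕ k < m → array σ 3 (toℕ k) (toℕ k) ≈ sum (B k)

    -- Vacuous until the scan has passed row `i₀`, since `row` has arbitrary contents before that.
    -- `HoldsCol` is guarded in the same way.
    HoldsRow : ℕ → State → Set
    HoldsRow m σ = toℕ i₀ < m → index σ row ≡ toℕ i₀

    HoldsCol : ℕ → State → Set ℓ
    HoldsCol m σ = toℕ j₀ < m → index σ col ≡ toℕ j₀ × ring σ kept ≈ C i₀ j₀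

    -- The counter `m` runs through the rows of `B`, then the rows of `C′`, then the columns of
    -- `C′`.
    Inv₁ Inv₂ Inv₃ : ℕ → State → Set ℓ
    Inv₁ m σ = Setup σ × index σ outer ≡ m × HoldsRowSums m σ
    Inv₂ m σ = Setup σ × index σ outer ≡ m × HoldsRowSums q σ × HoldsRow m σ
    Inv₃ m σ = Setup σ × index σ outer ≡ m × index σ row ≡ toℕ i₀ × HoldsCol m σ

    -- Besides the accumulations, a round of the first loop has a store and an increment. The second
    -- has a copy, then a test, at most one assignment and an increment. The third has a load, a
    -- test, at most two assignments and an increment.
    T₁ T₂ T₃ : ℕ
    T₁ = 3 + (r * 6 + 2)
    T₂ = 3 + (q * 6 + (1 + (3 + (r * 6 + 3))))
    T₃ = 3 + (q * 6 + 5)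

    sumRowsOfB-step : ∀ (k : Fin q) σ → Inv₁ (toℕ k) σ →
      Executes sumRowsOfB σ T₁ (Inv₁ (suc (toℕ k)))
    sumRowsOfB-step k σ (setup@(_ , _ , r≡ , one≡ , _ , holdsB , _) , outer≡ , sums) =
      executes-accumulate loadB (array σ 1 (toℕ k)) ≡.refl r≡ one≡
        (λ σ′ (index≡ , _ , array≡) →
          1 , _ , s≤s z≤n , (λ _ → ≡.refl) , ≡.refl , ≡.refl , ≡.refl , ≡.refl ,
          cong₂ (λ f x → f 1 x (index σ′ inner)) array≡ (≡.trans (index≡ outer ≡.refl) outer≡))
        λ σ′ frame acc≈ → executes-store (executes-setIndex (halts
          ( Setup-frame σ σ′ frame setup
          , increment≡ σ′ (Setup-frame σ σ′ frame setup) (outer′ σ′ frame)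
          , sums′ σ′ frame (trans acc≈ (sum-cong-≋ (holdsB k))))))
      where
      outer′ : ∀ σ′ → Frame σ σ′ → index σ′ outer ≡ toℕ k
      outer′ σ′ (index≡ , _) = ≡.trans (index≡ outer ≡.refl) outer≡

      sums′ : ∀ σ′ → Frame σ σ′ → ring σ′ acc ≈ sum (B k) →
        HoldsRowSums (suc (toℕ k)) (setArray 3 (index σ′ outer) (index σ′ outer) (ring σ′ acc) σ′)
      -- Either `k′` is the diagonal cell just stored, or it lies strictly below `k` and its cell is
      -- untouched.
      sums′ σ′ frame acc≈ k′ k′<1+k with k′ Fin.≟ k
      ... | yes ≡.refl rewrite outer′ σ′ frame | ≡⇒≡ᵇ≡true (≡.refl {x = toℕ k}) = acc≈
      ... | no k′≢k
        rewrite outer′ σ′ frame | ≢⇒≡ᵇ≡false (λ eq → k′≢k (toℕ-injective eq)) | proj₂ (proj₂ frame) =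
        sums k′ (ℕ.≤∧≢⇒< (ℕ.≤-pred k′<1+k) (λ eq → k′≢k (toℕ-injective eq)))

    findRow-step : ∀ (i : Fin p) σ → Inv₂ (toℕ i) σ → Executes findRow σ T₂ (Inv₂ (suc (toℕ i)))
    findRow-step i σ (setup@(_ , q≡ , _ , one≡ , holdsA , _) , outer≡ , sums , found) =
      executes-accumulate loadAv (λ k → array σ 0 (toℕ i) k ⊙ array σ 3 k k) ≡.refl q≡ one≡
        (λ σ′ (index≡ , _ , array≡) →
          3 , _ , ≤-refl , (λ _ → ≡.refl) , ≡.refl , ≡.refl , ≡.refl , ≡.refl ,
          cong₂ (λ f x → f 0 x (index σ′ inner) ⊙ f 3 (index σ′ inner) (index σ′ inner))
                array≡ (≡.trans (index≡ outer ≡.refl) outer≡))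
        λ σ₁ frame₁ acc≈ → executes-setRing
          (compareWithC′ _ (Setup-frame σ σ₁ frame₁ setup)
            (≡.trans (proj₁ frame₁ outer ≡.refl) outer≡)
            (λ k k<q → trans (reflexive (cong (λ f → f 3 (toℕ k) (toℕ k)) (proj₂ (proj₂ frame₁)))) (sums k k<q))
            (λ i₀<i → ≡.trans (proj₁ frame₁ row ≡.refl) (found i₀<i))
            -- The accumulated value is the `i`-th entry of A(B1), hence the `i`-th row sum of `C`.
            (trans acc≈ (trans (sum-cong-≋ (λ k → *-cong (holdsA i k) (sums k (toℕ<n k))))
                               (⊗-rowSum R A B i))))
      where
      compareWithC′ : ∀ σ → Setup σ → index σ outer ≡ toℕ i → HoldsRowSums q σ → HoldsRow (toℕ i) σ →
        ring σ kept ≈ sum (C i) →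
        Executes (accumulate 2 loadC′
          (ifThenElse (equalᴿ acc kept) [] (setIndex row (copy outer) ∷ []) ∷ increment))
          σ (3 + (r * 6 + 3)) (Inv₂ (suc (toℕ i)))
      compareWithC′ σ setup@(_ , _ , r≡ , one≡ , _ , _ , holdsC′) outer≡ sums found kept≈ =
        executes-accumulate loadC′ (array σ 2 (toℕ i)) ≡.refl r≡ one≡
          (λ σ′ (index≡ , _ , array≡) →
            1 , _ , s≤s z≤n , (λ _ → ≡.refl) , ≡.refl , ≡.refl , ≡.refl , ≡.refl ,
            cong₂ (λ f x → f 2 x (index σ′ inner)) array≡ (≡.trans (index≡ outer ≡.refl) outer≡))
          λ σ′ frame acc≈ → branch σ′ (Setup-frame σ σ′ frame setup)
            (≡.trans (proj₁ frame outer ≡.refl) outer≡)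
            (λ k k<q → trans (reflexive (cong (λ f → f 3 (toℕ k) (toℕ k)) (proj₂ (proj₂ frame)))) (sums k k<q))
            (λ i₀<i → ≡.trans (proj₁ frame row ≡.refl) (found i₀<i))
            (trans (reflexive (proj₁ (proj₂ frame))) kept≈)
            (trans acc≈ (sum-cong-≋ (holdsC′ i)))
        where
        branch : ∀ σ → Setup σ → index σ outer ≡ toℕ i → HoldsRowSums q σ → HoldsRow (toℕ i) σ →
          ring σ kept ≈ sum (C i) → ring σ acc ≈ sum (C′ i) →
          Executes (ifThenElse (equalᴿ acc kept) [] (setIndex row (copy outer) ∷ []) ∷ increment)
            σ 3 (Inv₂ (suc (toℕ i)))
        -- Only row `i₀` fails the test and is recorded. In any other row, `i₀ < suc i` sharpens to
        -- `i₀ < i`, so an earlier record persists.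
        branch σ setup outer≡ sums found kept≈ acc≈ with i₀ Fin.≟ i
        ... | yes ≡.refl = executes-else
          (dec-false (_ ≟ _) (λ eq → rowSum≉ (trans (sym acc≈) (trans eq kept≈))))
          (executes-setIndex (executes-setIndex (halts
            (setup , increment≡ σ setup outer≡ , sums , λ _ → outer≡))))
        ... | no i₀≢i = executes-then
          (dec-true (_ ≟ _) (trans acc≈ (trans (rowSum≈ i i₀≢i) (sym kept≈))))
          (weaken (s≤s z≤n) (executes-setIndex (halts
            ( setup , increment≡ σ setup outer≡ , sums
            , λ i₀<1+i → found (ℕ.≤∧≢⇒< (ℕ.≤-pred i₀<1+i) (λ eq → i₀≢i (toℕ-injective eq)))))))

    -- Each entry of row `i₀` of `C` is computed afresh as an inner product. It disagrees with `C′`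
    -- only in column `j₀`, where `acc` is the very value to be stored later.
    findCol-step : ∀ (j : Fin r) σ → Inv₃ (toℕ j) σ → Executes findCol σ T₃ (Inv₃ (suc (toℕ j)))
    findCol-step j σ (setup@(_ , q≡ , _ , one≡ , holdsA , holdsB , _) , outer≡ , row≡ , found) =
      executes-accumulate loadAB (λ k → array σ 0 (toℕ i₀) k ⊙ array σ 1 k (toℕ j)) ≡.refl q≡ one≡
        (λ σ′ (index≡ , _ , array≡) →
          3 , _ , ≤-refl , (λ _ → ≡.refl) , ≡.refl , ≡.refl , ≡.refl , ≡.refl ,
          ≡.trans
            (cong₂ (λ f x → f 0 x (index σ′ inner) ⊙ f 1 (index σ′ inner) (index σ′ outer))
                   array≡ (≡.trans (index≡ row ≡.refl) row≡))
            (cong (λ y → array σ 0 (toℕ i₀) (index σ′ inner) ⊙ array σ 1 (index σ′ inner) y)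
                  (≡.trans (index≡ outer ≡.refl) outer≡)))
        λ σ′ frame acc≈ → branch σ′ (Setup-frame σ σ′ frame setup)
          (≡.trans (proj₁ frame outer ≡.refl) outer≡)
          (≡.trans (proj₁ frame row ≡.refl) row≡)
          (λ j₀<j → ≡.trans (proj₁ frame col ≡.refl) (proj₁ (found j₀<j)) ,
                    trans (reflexive (proj₁ (proj₂ frame))) (proj₂ (found j₀<j)))
          (trans acc≈ (sum-cong-≋ (λ k → *-cong (holdsA i₀ k) (holdsB k j))))
      where
      branch : ∀ σ → Setup σ → index σ outer ≡ toℕ j → index σ row ≡ toℕ i₀ → HoldsCol (toℕ j) σ →
        ring σ acc ≈ C i₀ j →
        Executes
          (setRing term (load 2 row outer) ∷
           ifThenElse (equalᴿ acc term) [] (setIndex col (copy outer) ∷ setRing kept (copy acc) ∷ []) ∷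
           increment)
          σ 5 (Inv₃ (suc (toℕ j)))
      branch σ setup@(_ , _ , _ , _ , _ , _ , holdsC′) outer≡ row≡ found acc≈ =
        executes-setRing compareTerm
        where
        term≈ : array σ 2 (index σ row) (index σ outer) ≈ C′ i₀ j
        term≈ = trans (reflexive (cong₂ (array σ 2) row≡ outer≡)) (holdsC′ i₀ j)

        compareTerm : Executes
          (ifThenElse (equalᴿ acc term) [] (setIndex col (copy outer) ∷ setRing kept (copy acc) ∷ []) ∷
           increment)
          (setRingReg term (array σ 2 (index σ row) (index σ outer)) σ) 4 (Inv₃ (suc (toℕ j)))
        compareTerm with j₀ Fin.≟ j
        ... | yes ≡.refl = executes-else
          (dec-false (_ ≟ _) (λ eq → proj₁ (proj₂ d) (trans (sym term≈) (trans (sym eq) acc≈))))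
          (executes-setIndex (executes-setRing (executes-setIndex (halts
            (setup , increment≡ σ setup outer≡ , row≡ , λ _ → outer≡ , acc≈)))))
        ... | no j₀≢j = executes-then
          (dec-true (_ ≟ _)
            (trans acc≈ (trans (sym (C′≈C i₀ j (λ eq → j₀≢j (cong proj₂ eq)))) (sym term≈))))
          (weaken (s≤s z≤n) (executes-setIndex (halts
            ( setup , increment≡ σ setup outer≡ , row≡
            , λ j₀<1+j → found (ℕ.≤∧≢⇒< (ℕ.≤-pred j₀<1+j) (λ eq → j₀≢j (toℕ-injective eq)))))))

    correctEntry-corrects : ∀ σ → Inv₃ r σ → Executes correctEntry σ 3 (IsOutput (i₀ , j₀) C)
    correctEntry-corrects σ ((_ , _ , _ , _ , _ , _ , holdsC′) , _ , row≡ , found)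
      -- After all `r` columns the guard of `HoldsCol` is met.
      with found (toℕ<n j₀)
    ... | col≡ , kept≈ = executes-store (executes-setIndex (executes-setIndex (halts record
      { row-found = row≡
      ; col-found = col≡
      ; corrected = corrected
      })))
      where
      corrected : Holds (setArray 2 (index σ row) (index σ col) (ring σ kept) σ) 2 C
      corrected i j rewrite row≡ | col≡ with i₀ Fin.≟ i | j₀ Fin.≟ j
      ... | yes ≡.refl | yes ≡.refl
        rewrite ≡⇒≡ᵇ≡true (≡.refl {x = toℕ i₀}) | ≡⇒≡ᵇ≡true (≡.refl {x = toℕ j₀}) = kept≈
      ... | yes ≡.refl | no j₀≢j
        rewrite ≡⇒≡ᵇ≡true (≡.refl {x = toℕ i₀}) | ≢⇒≡ᵇ≡false (λ eq → j₀≢j (≡.sym (toℕ-injective eq))) =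
        trans (holdsC′ i j) (C′≈C i j (λ eq → j₀≢j (cong proj₂ eq)))
      -- The row comparison alone makes the conjunction in `setArray` false.
      ... | no i₀≢i | _
        rewrite ≢⇒≡ᵇ≡false (λ eq → i₀≢i (≡.sym (toℕ-injective eq))) =
        trans (holdsC′ i j) (C′≈C i j (λ eq → i₀≢i (cong proj₁ eq)))

    -- In the bound, the leading 2 counts the initial assignments, each `suc` after a loop its
    -- failing test, each `1 +` a reset of `outer`, and the final 3 the length of `correctEntry`.
    corrector-corrects : ∀ σ → IsInput A B C′ σ →
      Executes corrector σ
        (2 + (q * suc T₁ + suc (1 + (p * suc T₂ + suc (1 + (r * suc T₃ + suc 3))))))
        (IsOutput (i₀ , j₀) C)
    corrector-corrects σ input =
      executes-setIndex (executes-setIndex (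
      executes-for Inv₁ (λ _ _ ((_ , q≡ , _) , outer≡ , _) → outer≡ , q≡) sumRowsOfB-step
        ( (p-given , q-given , r-given , ≡.refl , A-given , B-given , C′-given)
        , ≡.refl , λ _ ())
        λ σ₁ (setup₁ , _ , sums) → executes-setIndex (
      executes-for Inv₂ (λ _ _ ((p≡ , _) , outer≡ , _) → outer≡ , p≡) findRow-step
        (setup₁ , ≡.refl , sums , λ ())
        λ σ₂ (setup₂ , _ , _ , found) → executes-setIndex (
      executes-for Inv₃ (λ _ _ ((_ , _ , r≡ , _) , outer≡ , _) → outer≡ , r≡) findCol-step
        (setup₂ , ≡.refl , found (toℕ<n i₀) , λ ())
        correctEntry-corrects))))
      where open IsInput input

-- The lower-order terms are absorbed because p and r are positive; the constant
-- 36 is attained at p = r = 1 and q = 0.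
time-bound : ∀ p q r → 1 ≤ p → 1 ≤ r →
  2 + (q * suc (3 + (r * 6 + 2)) + suc (1 +
    (p * suc (3 + (q * 6 + (1 + (3 + (r * 6 + 3))))) + suc (1 +
    (r * suc (3 + (q * 6 + 5)) + suc 3)))))
  ≤ 36 * (p * q + q * r + p * r)
time-bound (suc p) q (suc r) _ _ =
  ≤-trans (m≤m+n _ _) (≤-reflexive (slack p q r))
  where
  -- The summand beginning with `48 * q` is the exact gap between cost and bound after `p` and `r`
  -- are shifted by one. It has no constant term, since 36 is attained.
  slack : ∀ p q r →
    2 + (q * suc (3 + (suc r * 6 + 2)) + suc (1 +
      (suc p * suc (3 + (q * 6 + (1 + (3 + (suc r * 6 + 3))))) + suc (1 +
      (suc r * suc (3 + (q * 6 + 5)) + suc 3)))))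
    + (48 * q + 24 * (q * r) + 30 * (p * q) + 19 * p + 21 * r + 30 * (p * r))
    ≡ 36 * (suc p * q + q * suc r + suc p * suc r)
  slack = solve-∀

theorem1 : ∀ c ℓ →
    Σ[ P ∈ Program ] Σ[ K ∈ ℕ ]
      ((R : Ring c ℓ) (_≟_ : Decidable (Ring._≈_ R)) →
       let open Ring R using (Carrier)
           open Machine R _≟_
       in
       ∀ p q r (A : Matrix Carrier p q) (B : Matrix Carrier q r) (C′ : Matrix Carrier p r) →
       (d : DifferInExactlyOneEntry R C′ (_⊗_ R A B)) →
       ∀ σ → IsInput A B C′ σ →
       HaltsWithin (K * (p * q + q * r + p * r)) P σ (IsOutput (proj₁ d) (_⊗_ R A B)))
theorem1 c ℓ = corrector , 36 , λ R _≟_ p q r A B C′ d σ input →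
  Executes⇒HaltsWithin R _≟_
    (weaken R _≟_
      -- The position of the error inhabits `Fin p × Fin r`, so `p` and `r` are positive.
      (time-bound p q r (Fin⇒1≤ (proj₁ (proj₁ d))) (Fin⇒1≤ (proj₂ (proj₁ d))))
      (corrector-corrects R _≟_ A B C′ d σ input))
  where
  Fin⇒1≤ : ∀ {n} → Fin n → 1 ≤ n
  Fin⇒1≤ i = ≤-trans (s≤s z≤n) (toℕ<n i)
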